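{- Let $\Gamma_1$ and $\Gamma_2$ be $2\ell$-regular orthogonal signed graphs. Suppose $\Gamma_1$ is splittable at $a,b$ and $\Gamma_2$ is splittable at $a',b'$. If $\Gamma_1$ is $3$-connected, then the split and join $\Gamma_1^{a,b}*\Gamma_2^{a',b'}$ is a $2\ell$-regular orthogonal signed graph.
   Context: A signed graph $\Gamma=(G,\sigma)$ is a simple graph $G$ (the underlying graph) with a function $\sigma:E(G)\to\{1,-1\}$. Graph properties of $\Gamma$ such as regularity and connectivity are those of $G$. Its signed adjacency matrix $A(\Gamma)$ has entry $\sigma(ij)$ at $(i,j)$ if $ij\in E(G)$ and $0$ otherwise. $\Gamma$ is orthogonal if $G$ is connected and $A(\Gamma)^2=D$, where $D$ is the diagonal matrix of vertex degrees of $G$. $N_v=N(v)$ denotes the set of neighbors of $v$ in $G$. Splittable: Let $\Gamma$ be a $2\ell$-regular orthogonal signed graph which possesses distinct vertices $a,b$ such that $|N_a\cap N_b|=2\ell$. Let $P=\{p_1,\dots,p_\ell\}$ be the set of midpoints of the positive 2-walks from $a$ to $b$, i.e. the $w\in N_a\cap N_b$ with $\sigma(aw)\sigma(wb)=1$, and let $M=\{m_1,\dots,m_\ell\}$ be the set of midpoints of the negative 2-walks from $a$ to $b$, i.e. the $w\in N_a\cap N_b$ with $\sigma(aw)\sigma(wb)=-1$ (each set has size $\ell$ by orthogonality). $\Gamma$ is splittable at $a,b$ if $a$ and $b$ are the only vertices of $\Gamma$ that have neighbors in both $P$ and $M$. Split and join: Let $\Gamma_1$ be splittable at $a,b$ with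 corresponding sets $P=\{p_1,\dots,p_\ell\}$, $M=\{m_1,\dots,m_\ell\}$, and let $\Gamma_2$ be splittable at $a',b'$ with corresponding sets $P'=\{p_1',\dots,p_\ell'\}$, $M'=\{m_1',\dots,m_\ell'\}$. The split and join $\Gamma_1^{a,b}*\Gamma_2^{a',b'}$ is the signed graph obtained from the disjoint union of $\Gamma_1$ and $\Gamma_2$ by deleting $a,b,a',b'$ and their incident edges and creating new vertices $a_1,a_2,b_1,b_2$ with $N(a_1)=N(a_2)=\{p_1,\dots,p_\ell,m_1',\dots,m_\ell'\}$ and $N(b_1)=N(b_2)=\{p_1',\dots,p_\ell',m_1,\dots,m_\ell\}$, where the edges $\{a_1,m_i'\}$ and $\{b_2,m_i\}$ ($1\leqslant i\leqslant\ell$) are negative and all other new edges are positive.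
   Formalization: The split and join is formed after switching each graph at the neighbours joined to a (resp. a′) by a negative edge, so that all edges at a and a′ are positive; without this normalisation the result need not be orthogonal. -}

module Defs where

open import Data.Empty using (⊥-elim-irr)
open import Data.Fin.Base as Fin using (Fin)
import Data.Fin.Properties as Finₚ
open import Data.Integer.Base as ℤ using (ℤ; +_; 0ℤ; _◃_)
open import Data.Irrelevant using ([_])
open import Data.List.Base using (List; []; _∷_; _++_; map; mapMaybe; filter; foldr; length; allFin)
open import Data.List.Membership.Propositional using (_∈_; _∉_)
open import Data.List.Membership.Propositional.Properties using (∈-++⁺ˡ; ∈-++⁺ʳ; ∈-map⁺; ∈-map⁻; ∈-allFin)
open import Data.List.Relation.Unary.All as All using (All; []; _∷_)
open import Data.List.Relation.Unary.Any using (here; there)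
open import Data.List.Relation.Unary.AllPairs using ([]; _∷_)
open import Data.List.Relation.Unary.Unique.Propositional using (Unique)
import Data.List.Relation.Unary.Unique.Propositional.Properties as Uniqueₚ
import Data.List.Membership.DecPropositional as DecMembership
open import Data.Maybe.Base as Maybe using (Maybe; just; nothing; fromMaybe; zipWith; _>>=_)
open import Data.Maybe using (Is-just)
import Data.Maybe.Relation.Unary.Any as MaybeAny
open import Data.Nat.Base using (ℕ; _*_; _<_)
open import Level using (0ℓ)
open import Data.Product.Base using (∃-syntax; _×_; _,_)
import Data.Refinement as Refinement
open Refinement using (Refinement-syntax; value; _,_)
open import Data.Sign.Base as Sign using (Sign)
import Data.Sign.Properties as Signₚ
open import Data.Sum.Base using (_⊎_; inj₁; inj₂)
import Data.Sum.Properties as Sumₚ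
open import Data.Unit.Base using (tt)
open import Function.Bundles using (_⇔_)
open import Relation.Binary.Construct.Closure.ReflexiveTransitive using (Star)
open import Relation.Binary.Definitions using (DecidableEquality)
open import Relation.Binary.PropositionalEquality
open import Relation.Nullary using (Dec; yes; no; ¬_)
open import Relation.Nullary.Decidable using (_×-dec_)
open import Relation.Unary using (Pred; Decidable)

record Finite (V : Set) : Set where
  field
    _≟_      : DecidableEquality V
    elements : List V
    unique   : Unique elements
    complete : ∀ v → v ∈ elements

  count : {P : Pred V 0ℓ} → Decidable P → ℕ
  count P? = length (filter P? elements)

  ∑ : (V → ℤ) → ℤ
  ∑ f = foldr ℤ._+_ 0ℤ (map f elements)

fin-finite : ∀ n → Finite (Fin n)
fin-finite n = record
  { _≟_      = Finₚ._≟_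
  ; elements = allFin n
  ; unique   = Uniqueₚ.allFin⁺ n
  ; complete = ∈-allFin
  }

⊎-finite : ∀ {V W} → Finite V → Finite W → Finite (V ⊎ W)
⊎-finite {V} {W} F G = record
  { _≟_      = Sumₚ.≡-dec F._≟_ G._≟_
  ; elements = map inj₁ F.elements ++ map inj₂ G.elements
  ; unique   = Uniqueₚ.++⁺ (Uniqueₚ.map⁺ Sumₚ.inj₁-injective F.unique)
                           (Uniqueₚ.map⁺ Sumₚ.inj₂-injective G.unique)
                           disjoint
  ; complete = λ where
      (inj₁ v) → ∈-++⁺ˡ (∈-map⁺ inj₁ (F.complete v))
      (inj₂ w) → ∈-++⁺ʳ (map inj₁ F.elements) (∈-map⁺ inj₂ (G.complete w))
  }
  where
  module F = Finite F
  module G = Finite G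
  disjoint : ∀ {x} → ¬ (x ∈ map inj₁ F.elements × x ∈ map inj₂ G.elements)
  disjoint (p , q) with ∈-map⁻ inj₁ p | ∈-map⁻ inj₂ q
  ... | _ , _ , refl | _ , _ , ()

infixl 6 _∖_
_∖_ : (V : Set) → List V → Set
V ∖ X = [ v ∈ V ∣ v ∉ X ]

module _ {V : Set} (F : Finite V) (X : List V) where
  open Finite F
  open DecMembership _≟_ using (_∈?_)

  retain : V → Maybe (V ∖ X)
  retain v with v ∈? X
  ... | yes _ = nothing
  ... | no ∉X = just (v , [ ∉X ])

  private
    fresh : ∀ {v ∉X} vs → All (v ≢_) vs → All ((v , ∉X) ≢_) (mapMaybe retain vs)
    fresh []       []       = []
    fresh (w ∷ vs) (v≢w ∷ p) with w ∈? X
    ... | yes _ = fresh vs p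
    ... | no _  = (λ eq → v≢w (cong value eq)) ∷ fresh vs p

    retain-unique : ∀ vs → Unique vs → Unique (mapMaybe retain vs)
    retain-unique []       []      = []
    retain-unique (v ∷ vs) (p ∷ u) with v ∈? X
    ... | yes _ = retain-unique vs u
    ... | no _  = fresh vs p ∷ retain-unique vs u

    retain-complete : ∀ vs (x : V ∖ X) → value x ∈ vs → x ∈ mapMaybe retain vs
    retain-complete (w ∷ vs) (v , [ ∉X ]) i with w ∈? X | i
    ... | yes ∈X | here refl = ⊥-elim-irr (∉X ∈X)
    ... | yes _  | there j   = retain-complete vs _ j
    ... | no _   | here refl = here refl
    ... | no _   | there j   = there (retain-complete vs _ j)

  ∖-finite : Finite (V ∖ X)
  ∖-finite = record
    { _≟_      = Refinement._≟_ _≟_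
    ; elements = mapMaybe retain elements
    ; unique   = retain-unique elements unique
    ; complete = λ x → retain-complete elements x (complete (value x))
    }

-- The pair (G , σ) is packed into one map: `edge u v` is `nothing` when
-- u and v are not adjacent, and `just (σ uv)` when they are.
record SignedGraph : Set₁ where
  field
    V        : Set
    finite   : Finite V
    edge     : V → V → Maybe Sign
    edge-sym : ∀ u v → edge u v ≡ edge v u
    loopless : ∀ v → edge v v ≡ nothing

  open Finite finite public

  Adj : V → V → Set
  Adj u v = Is-just (edge u v)

  adj? : ∀ u v → Dec (Adj u v)
  adj? u v = MaybeAny.dec (λ _ → yes tt) (edge u v)

  order : ℕ
  order = length elements

  degree : V → ℕ
  degree v = count (adj? v)

  commonNeighbours : V → V → ℕ
  commonNeighbours u v = count (λ w → adj? u w ×-dec adj? v w)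

  -- The sign σ(uw)σ(wv) of the 2-walk u, w, v, if it is a walk at all.
  walkSign : V → V → V → Maybe Sign
  walkSign u w v = zipWith Sign._*_ (edge u w) (edge w v)

open SignedGraph using (V; edge; finite)

module _ (Γ : SignedGraph) where
  open SignedGraph Γ hiding (V; edge; finite)

  Regular : ℕ → Set
  Regular k = ∀ v → degree v ≡ k

  Connected : Set
  Connected = V Γ × (∀ u v → Star Adj u v)

  A D : V Γ → V Γ → ℤ
  A u v with edge Γ u v
  ... | nothing = 0ℤ
  ... | just s  = s ◃ 1
  D u v with u ≟ v
  ... | yes _ = + degree u
  ... | no _  = 0ℤ

  Orthogonal : Set
  Orthogonal = Connected × (∀ u v → ∑ (λ w → A u w ℤ.* A w v) ≡ D u v)

  -- Midpoints of the positive (P) and of the negative (M) 2-walks from a to b.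
  P M : V Γ → V Γ → V Γ → Set
  P a b w = walkSign a w b ≡ just Sign.+
  M a b w = walkSign a w b ≡ just Sign.-

  record Splittable (ℓ : ℕ) (a b : V Γ) : Set where
    field
      distinct : a ≢ b
      common   : commonNeighbours a b ≡ 2 * ℓ
      only-a,b : ∀ v → ((∃[ p ] (P a b p × Adj v p)) × (∃[ m ] (M a b m × Adj v m)))
                       ⇔ (v ≡ a ⊎ v ≡ b)

infixl 6 _−_
_−_ : (Γ : SignedGraph) → List (V Γ) → SignedGraph
Γ − X = record
  { V        = V Γ ∖ X
  ; finite   = ∖-finite (finite Γ) X
  ; edge     = λ u v → edge Γ (value u) (value v)
  ; edge-sym = λ u v → SignedGraph.edge-sym Γ (value u) (value v)
  ; loopless = λ v → SignedGraph.loopless Γ (value v)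
  }

-- Repetitions in X are harmless: the lists of length < k have as underlying
-- sets exactly the vertex sets of size < k.
KConnected : ℕ → SignedGraph → Set
KConnected k Γ = k < SignedGraph.order Γ × (∀ X → length X < k → Connected (Γ − X))

switch : (Γ : SignedGraph) → (V Γ → Sign) → SignedGraph
switch Γ θ = record
  { V        = V Γ
  ; finite   = finite Γ
  ; edge     = λ u v → Maybe.map (λ s → θ u Sign.* s Sign.* θ v) (edge Γ u v)
  ; edge-sym = λ u v → trans (cong (Maybe.map _) (SignedGraph.edge-sym Γ u v))
                             (mapped u v (edge Γ v u))
  ; loopless = λ v → cong (Maybe.map _) (SignedGraph.loopless Γ v)
  }
  where
  mapped : ∀ u v (e : Maybe Sign) → Maybe.map (λ s → θ u Sign.* s Sign.* θ v) e
                                  ≡ Maybe.map (λ s → θ v Sign.* s Sign.* θ u) e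
  mapped u v nothing  = refl
  mapped u v (just s) = cong just (begin
    θ u Sign.* s Sign.* θ v    ≡⟨ Signₚ.*-comm (θ u Sign.* s) (θ v) ⟩
    θ v Sign.* (θ u Sign.* s)  ≡⟨ cong (θ v Sign.*_) (Signₚ.*-comm (θ u) s) ⟩
    θ v Sign.* (s Sign.* θ u)  ≡⟨ Signₚ.*-assoc (θ v) s (θ u) ⟨
    θ v Sign.* s Sign.* θ u    ∎)
    where open ≡-Reasoning

-- The switching of Γ at the neighbours w of a with σ(aw) = -1: the
-- representative of the switching class of Γ in which all edges at a are
-- positive. When b is another vertex that is not adjacent to a, the sets P
-- and M of the pair a, b do not change, and Γ itself is unchanged if its
-- edges at a are already positive.
positiveAt : (Γ : SignedGraph) → V Γ → SignedGraph
positiveAt Γ a = switch Γ (λ w → fromMaybe Sign.+ (edge Γ a w))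

New : Set
New = Fin 4

pattern a₁ = Fin.zero
pattern a₂ = Fin.suc Fin.zero
pattern b₁ = Fin.suc (Fin.suc Fin.zero)
pattern b₂ = Fin.suc (Fin.suc (Fin.suc Fin.zero))

-- Signs of the edges from a new vertex to a vertex of Γ₁ (attach₁) or of Γ₂
-- (attach₂). The second argument says on which side of its graph that vertex
-- lies: `+` for P or P′, `-` for M or M′.
attach₁ : New → Sign → Maybe Sign
attach₁ a₁ Sign.+ = just Sign.+
attach₁ a₂ Sign.+ = just Sign.+
attach₁ b₁ Sign.+ = nothing
attach₁ b₂ Sign.+ = nothing
attach₁ a₁ Sign.- = nothing
attach₁ a₂ Sign.- = nothing
attach₁ b₁ Sign.- = just Sign.+
attach₁ b₂ Sign.- = just Sign.-

attach₂ : New → Sign → Maybe Sign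
attach₂ a₁ Sign.+ = nothing
attach₂ a₂ Sign.+ = nothing
attach₂ b₁ Sign.+ = just Sign.+
attach₂ b₂ Sign.+ = just Sign.+
attach₂ a₁ Sign.- = just Sign.-
attach₂ a₂ Sign.- = just Sign.+
attach₂ b₁ Sign.- = nothing
attach₂ b₂ Sign.- = nothing

-- The new edges have signs that do not depend on those of the edges at a, b,
-- a′ and b′. This is meant for representatives with all edges at a and a′
-- positive; for other representatives the result need not be orthogonal.
splitJoin : (Γ₁ : SignedGraph) (a b : V Γ₁) (Γ₂ : SignedGraph) (a′ b′ : V Γ₂) → SignedGraph
splitJoin Γ₁ a b Γ₂ a′ b′ = record
  { V        = W
  ; finite   = ⊎-finite (finite Δ₁) (⊎-finite (finite Δ₂) (fin-finite 4))
  ; edge     = e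
  ; edge-sym = e-sym
  ; loopless = e-loopless
  }
  where
  Δ₁ Δ₂ : SignedGraph
  Δ₁ = Γ₁ − (a ∷ b ∷ [])
  Δ₂ = Γ₂ − (a′ ∷ b′ ∷ [])

  W : Set
  W = V Δ₁ ⊎ V Δ₂ ⊎ New

  new₁ : New → V Δ₁ → Maybe Sign
  new₁ x u = SignedGraph.walkSign Γ₁ a (value u) b >>= attach₁ x

  new₂ : New → V Δ₂ → Maybe Sign
  new₂ x u = SignedGraph.walkSign Γ₂ a′ (value u) b′ >>= attach₂ x

  e : W → W → Maybe Sign
  e (inj₁ u)        (inj₁ v)        = edge Δ₁ u v
  e (inj₁ u)        (inj₂ (inj₁ v)) = nothing
  e (inj₁ u)        (inj₂ (inj₂ y)) = new₁ y u
  e (inj₂ (inj₁ u)) (inj₁ v)        = nothing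
  e (inj₂ (inj₁ u)) (inj₂ (inj₁ v)) = edge Δ₂ u v
  e (inj₂ (inj₁ u)) (inj₂ (inj₂ y)) = new₂ y u
  e (inj₂ (inj₂ x)) (inj₁ v)        = new₁ x v
  e (inj₂ (inj₂ x)) (inj₂ (inj₁ v)) = new₂ x v
  e (inj₂ (inj₂ x)) (inj₂ (inj₂ y)) = nothing

  e-sym : ∀ u v → e u v ≡ e v u
  e-sym (inj₁ u)        (inj₁ v)        = SignedGraph.edge-sym Δ₁ u v
  e-sym (inj₁ u)        (inj₂ (inj₁ v)) = refl
  e-sym (inj₁ u)        (inj₂ (inj₂ y)) = refl
  e-sym (inj₂ (inj₁ u)) (inj₁ v)        = refl
  e-sym (inj₂ (inj₁ u)) (inj₂ (inj₁ v)) = SignedGraph.edge-sym Δ₂ u v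
  e-sym (inj₂ (inj₁ u)) (inj₂ (inj₂ y)) = refl
  e-sym (inj₂ (inj₂ x)) (inj₁ v)        = refl
  e-sym (inj₂ (inj₂ x)) (inj₂ (inj₁ v)) = refl
  e-sym (inj₂ (inj₂ x)) (inj₂ (inj₂ y)) = refl

  e-loopless : ∀ v → e v v ≡ nothing
  e-loopless (inj₁ u)        = SignedGraph.loopless Δ₁ u
  e-loopless (inj₂ (inj₁ u)) = SignedGraph.loopless Δ₂ u
  e-loopless (inj₂ (inj₂ x)) = refl

{-# OPTIONS --safe #-}

-- Switch so that all edges at a and a′ are positive. For a vertex u of Γ₁ other
-- than a and b, the four entries of u in the new rows a₁, a₂, b₁, b₂ have the same
-- products with those of another vertex of Γ₁ as its two entries in the old rows
-- a, b, so products of old rows of one side do not change; for vertices on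
-- different sides they cancel. Conversely twice a new row x is a combination
-- k₁ x · a + l₁ x · b on Γ₁ and k₂ x · a′ + l₂ x · b′ on Γ₂ of old rows. Hence it
-- is orthogonal to the other old rows, and the new rows are orthogonal because
-- the 4 × 4 matrix (k₁ l₁ k₂ l₂) is a Hadamard matrix. Degrees are the diagonal
-- entries of the square of the adjacency matrix. As for connectivity, Γ₁ without
-- a and b is connected and meets the neighbourhood of each new vertex, while a
-- path in Γ₂ to a′ leaves Γ₂ without a′ and b′ through a neighbour of a₁ or b₁.
module Submission where

open import Defs
open import Data.Empty using (⊥-elim-irr)
import Data.Fin.Properties as Finₚ
open import Data.Integer.Base as ℤ using (ℤ; +_; 0ℤ; 1ℤ; -1ℤ; _◃_)
import Data.Integer.Properties as ℤₚ
open import Data.Integer.Tactic.RingSolver using (solve-∀)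
open import Data.Irrelevant using ([_])
open import Data.List.Base using (List; []; _∷_; _++_; map; foldr; filter; length)
open import Data.List.Properties using (map-∘; map-cong)
open import Data.List.Membership.Propositional using (_∈_; _∉_)
open import Data.List.Membership.Propositional.Properties using (∈-map⁺; ∈-map⁻; ∈-filter⁺; ∈-filter⁻)
open import Data.List.Membership.Propositional.Properties.WithK using (unique∧set⇒bag)
import Data.List.Membership.DecPropositional as DecMembership
open import Data.List.Relation.Binary.BagAndSetEquality using (∼bag⇒↭)
open import Data.List.Relation.Binary.Permutation.Propositional using (_↭_; ↭⇒↭ₛ)
import Data.List.Relation.Binary.Permutation.Propositional.Properties as ↭ₚ
import Data.List.Relation.Binary.Permutation.Setoid.Properties as ↭ₛₚ
open import Data.List.Relation.Binary.Pointwise using (Pointwise-≡⇒≡)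
open import Data.List.Relation.Binary.Sublist.Propositional using (⊆-refl)
open import Data.List.Relation.Binary.Sublist.Propositional.Properties using (filter⁺; to-≋)
open import Data.List.Relation.Unary.All as All using ([]; _∷_)
open import Data.List.Relation.Unary.AllPairs using ([]; _∷_)
open import Data.List.Relation.Unary.Any using (here; there)
open import Data.List.Relation.Unary.Unique.Propositional using (Unique)
import Data.List.Relation.Unary.Unique.Propositional.Properties as Uniqueₚ
open import Data.Maybe.Base as Maybe using (Maybe; just; nothing; fromMaybe; zipWith; _>>=_)
open import Data.Maybe using (Is-just)
open import Data.Maybe.Relation.Unary.Any using (just)
open import Data.Nat.Base using (ℕ; _*_; s≤s; z≤n)
open import Data.Product.Base using (∃-syntax; _×_; _,_; proj₁; proj₂)
open import Data.Refinement using (value; _,_; value-injective)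
open import Data.Sign.Base as Sign using (Sign)
open import Data.Sum.Base using (inj₁; inj₂)
open import Data.Unit.Base using (tt)
open import Function.Base using (_∘_)
open import Function.Bundles using (mk⇔; Equivalence)
open import Level using (0ℓ)
open import Relation.Binary.Construct.Closure.ReflexiveTransitive using (Star; ε; _◅_; _◅◅_; gmap; reverse)
open import Relation.Binary.PropositionalEquality
  using (_≡_; _≢_; refl; sym; trans; cong; cong₂; subst; setoid; module ≡-Reasoning)
open import Relation.Nullary using (Dec; yes; no; contradiction)
open import Relation.Nullary.Decidable using (_×-dec_; _→-dec_; ¬?; from-yes)
open import Relation.Unary using (Pred; Decidable)
open SignedGraph using (V; edge; finite)

private
  variable
    U W : Set

open ≡-Reasoning

-- Finite sums

∑ₗ : List W → (W → ℤ) → ℤ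
∑ₗ xs f = foldr ℤ._+_ 0ℤ (map f xs)

∑ₗ-↭ : ∀ {xs ys : List W} f → xs ↭ ys → ∑ₗ xs f ≡ ∑ₗ ys f
∑ₗ-↭ f p = ↭ₛₚ.foldr-commMonoid (setoid ℤ) ℤₚ.+-0-isCommutativeMonoid (↭⇒↭ₛ (↭ₚ.map⁺ f p))

∑ₗ-++ : ∀ (xs ys : List W) f → ∑ₗ (xs ++ ys) f ≡ ∑ₗ xs f ℤ.+ ∑ₗ ys f
∑ₗ-++ []       ys f = sym (ℤₚ.+-identityˡ _)
∑ₗ-++ (x ∷ xs) ys f = trans (cong (ℤ._+_ (f x)) (∑ₗ-++ xs ys f)) (sym (ℤₚ.+-assoc (f x) _ _))

∑ₗ-map : ∀ (h : U → W) xs f → ∑ₗ (map h xs) f ≡ ∑ₗ xs (f ∘ h)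
∑ₗ-map h xs f = cong (foldr ℤ._+_ 0ℤ) (sym (map-∘ xs))

module _ (F : Finite W) where
  open Finite F

  ∑-cong : ∀ {f g} → (∀ w → f w ≡ g w) → ∑ f ≡ ∑ g
  ∑-cong f≗g = cong (foldr ℤ._+_ 0ℤ) (map-cong f≗g elements)

  ∑-linear : ∀ k l f g → ∑ (λ w → k ℤ.* f w ℤ.+ l ℤ.* g w) ≡ k ℤ.* ∑ f ℤ.+ l ℤ.* ∑ g
  ∑-linear k l f g = go elements
    where
    base : ∀ k l → 0ℤ ≡ k ℤ.* 0ℤ ℤ.+ l ℤ.* 0ℤ
    base = solve-∀
    step : ∀ k l x y s t → (k ℤ.* x ℤ.+ l ℤ.* y) ℤ.+ (k ℤ.* s ℤ.+ l ℤ.* t)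
                         ≡ k ℤ.* (x ℤ.+ s) ℤ.+ l ℤ.* (y ℤ.+ t)
    step = solve-∀
    go : ∀ xs → ∑ₗ xs (λ w → k ℤ.* f w ℤ.+ l ℤ.* g w) ≡ k ℤ.* ∑ₗ xs f ℤ.+ l ℤ.* ∑ₗ xs g
    go []       = base k l
    go (x ∷ xs) = trans (cong (ℤ._+_ (k ℤ.* f x ℤ.+ l ℤ.* g x)) (go xs)) (step k l (f x) (g x) _ _)

  ∑-*ˡ : ∀ k f → ∑ (λ w → k ℤ.* f w) ≡ k ℤ.* ∑ f
  ∑-*ˡ k f = begin
    ∑ (λ w → k ℤ.* f w)                  ≡⟨ ∑-cong (λ w → sym (ℤₚ.+-identityʳ (k ℤ.* f w))) ⟩
    ∑ (λ w → k ℤ.* f w ℤ.+ 0ℤ ℤ.* f w)  ≡⟨ ∑-linear k 0ℤ f f ⟩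
    k ℤ.* ∑ f ℤ.+ 0ℤ                     ≡⟨ ℤₚ.+-identityʳ _ ⟩
    k ℤ.* ∑ f                            ∎

  ∑-zero : ∀ {f} → (∀ w → f w ≡ 0ℤ) → ∑ f ≡ 0ℤ
  -- The zero summand is written as a product so that a factor `0ℤ` can be pulled out; `0ℤ` times
  -- the remaining sum computes to `0ℤ`.
  ∑-zero {f} f≗0 = trans (∑-cong {f} {λ _ → 0ℤ ℤ.* 0ℤ} f≗0) (∑-*ˡ 0ℤ (λ _ → 0ℤ))

∑-⊎ : ∀ (F : Finite U) (G : Finite W) f →
      Finite.∑ (⊎-finite F G) f ≡ Finite.∑ F (f ∘ inj₁) ℤ.+ Finite.∑ G (f ∘ inj₂)
∑-⊎ F G f = trans (∑ₗ-++ (map inj₁ (Finite.elements F)) _ f)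
                  (cong₂ ℤ._+_ (∑ₗ-map inj₁ (Finite.elements F) f)
                               (∑ₗ-map inj₂ (Finite.elements G) f))

-- The proof stored in the refinement is irrelevant and can only be used to reach a contradiction,
-- which is all that a negation asks for.
∖-∉ : ∀ (F : Finite W) {X} (w : W ∖ X) → value w ∉ X
∖-∉ F {X} (w , [ w∉X ]) w∈X = ⊥-elim-irr (w∉X w∈X)

-- The given enumeration and the one starting with `a` and `b` are both free of repetitions and have
-- the same members, so they are permutations of each other.
∑-∖ : ∀ (F : Finite W) {a b} → a ≢ b → ∀ f →
      Finite.∑ F f ≡ f a ℤ.+ (f b ℤ.+ Finite.∑ (∖-finite F (a ∷ b ∷ [])) (f ∘ value))
∑-∖ F {a} {b} a≢b f =
  trans (∑ₗ-↭ f (∼bag⇒↭ (unique∧set⇒bag (Finite.unique F) split-unique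
           (mk⇔ (λ _ → split-complete _) (λ _ → Finite.complete F _)))))
        (cong (λ s → f a ℤ.+ (f b ℤ.+ s)) (∑ₗ-map value (Finite.elements G) f))
  where
  open DecMembership (Finite._≟_ F) using (_∈?_)
  X    = a ∷ b ∷ []
  G    = ∖-finite F X
  rest = map value (Finite.elements G)

  outside : ∀ {w v} → w ∈ X → v ∈ rest → w ≢ v
  outside w∈X v∈rest refl with ∈-map⁻ value v∈rest
  ... | u , _ , refl = ∖-∉ F u w∈X

  split-unique : Unique (a ∷ b ∷ rest)
  split-unique = (a≢b ∷ All.tabulate (outside (here refl)))
               ∷ All.tabulate (outside (there (here refl)))
               ∷ Uniqueₚ.map⁺ value-injective (Finite.unique G)

  split-complete : ∀ w → w ∈ a ∷ b ∷ rest
  split-complete w with w ∈? X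
  ... | yes (here w≡a)         = here w≡a
  ... | yes (there (here w≡b)) = there (here w≡b)
  ... | no w∉X = there (there (∈-map⁺ value (Finite.complete G (w , [ w∉X ]))))

-- The list filtered by `P` is a sublist of the one filtered by `Q`, and a sublist of full length is
-- the whole list.
count-full : ∀ (F : Finite W) {P Q : Pred W 0ℓ} (P? : Decidable P) (Q? : Decidable Q) →
             (∀ {w} → P w → Q w) → Finite.count F P? ≡ Finite.count F Q? → ∀ {w} → Q w → P w
count-full F P? Q? P⊆Q eq {w} q = proj₂ (∈-filter⁻ P? {xs = elements}
    (subst (w ∈_) (sym same) (∈-filter⁺ Q? (complete w) q)))
  where
  open Finite F
  same : filter P? elements ≡ filter Q? elements
  same = Pointwise-≡⇒≡ (to-≋ eq (filter⁺ P? Q? (λ { refl → P⊆Q }) (⊆-refl {x = elements})))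

-- Rows of the adjacency matrix

-- Unlike `A`, this depends only on the value of the edge, so equations between edges transfer to
-- matrix entries by `cong`.
val : Maybe Sign → ℤ
val nothing  = 0ℤ
val (just s) = s ◃ 1

A≡val : ∀ Γ u v → A Γ u v ≡ val (edge Γ u v)
A≡val Γ u v with edge Γ u v
... | nothing = refl
... | just s  = refl

-- An entry of A² and, since A is symmetric, the inner product of two rows of A.
gram : (Γ : SignedGraph) → V Γ → V Γ → ℤ
gram Γ u v = SignedGraph.∑ Γ (λ w → val (edge Γ u w) ℤ.* val (edge Γ w v))

A²≡gram : ∀ Γ u v → SignedGraph.∑ Γ (λ w → A Γ u w ℤ.* A Γ w v) ≡ gram Γ u v
A²≡gram Γ u v = ∑-cong (finite Γ) λ w → cong₂ ℤ._*_ (A≡val Γ u w) (A≡val Γ w v)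

gram-sym : ∀ Γ u v → gram Γ u v ≡ gram Γ v u
gram-sym Γ u v = ∑-cong (finite Γ) λ w →
  trans (ℤₚ.*-comm (val (edge Γ u w)) _)
        (cong₂ (λ e f → val e ℤ.* val f) (edge-sym w v) (edge-sym u w))
  where open SignedGraph Γ using (edge-sym)

-- By symmetry every term is a square: 1 at a neighbour of `u` and 0 elsewhere.
gram-diagonal : ∀ Γ u → gram Γ u u ≡ + SignedGraph.degree Γ u
gram-diagonal Γ u = go elements
  where
  open SignedGraph Γ hiding (V; edge; finite)
  go : ∀ xs → ∑ₗ xs (λ w → val (edge Γ u w) ℤ.* val (edge Γ w u)) ≡ + length (filter (adj? u) xs)
  go []       = refl
  go (x ∷ xs) rewrite edge-sym x u with edge Γ u x
  ... | nothing       = trans (ℤₚ.+-identityˡ _) (go xs)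
  ... | just Sign.+ = cong (ℤ._+_ 1ℤ) (go xs)
  ... | just Sign.- = cong (ℤ._+_ 1ℤ) (go xs)

-- The equation A² = nI. For n = `+ k` it merges k-regularity with A² = D; connectivity is treated
-- separately.
record OrthogonalRows (Γ : SignedGraph) (n : ℤ) : Set where
  field
    norm       : ∀ u → gram Γ u u ≡ n
    orthogonal : ∀ {u v} → u ≢ v → gram Γ u v ≡ 0ℤ

open OrthogonalRows

orthogonalRows : ∀ Γ {k} → Regular Γ k → Orthogonal Γ → OrthogonalRows Γ (+ k)
orthogonalRows Γ reg (_ , A²≡D) = record
  { norm       = λ u → trans (gram-diagonal Γ u) (cong +_ (reg u))
  ; orthogonal = λ {u} {v} u≢v → trans (sym (A²≡gram Γ u v)) (trans (A²≡D u v) (D-off u≢v))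
  }
  where
  open SignedGraph Γ using (_≟_)
  D-off : ∀ {u v} → u ≢ v → D Γ u v ≡ 0ℤ
  D-off {u} {v} u≢v with u ≟ v
  ... | yes u≡v = contradiction u≡v u≢v
  ... | no _    = refl

regular-orthogonal : ∀ Γ {k} → Connected Γ → OrthogonalRows Γ (+ k) → Regular Γ k × Orthogonal Γ
regular-orthogonal Γ con S =
  (λ u → ℤₚ.+-injective (trans (sym (gram-diagonal Γ u)) (norm S u))) ,
  con , λ u v → trans (A²≡gram Γ u v) (gram≡D u v)
  where
  open SignedGraph Γ using (_≟_)
  gram≡D : ∀ u v → gram Γ u v ≡ D Γ u v
  gram≡D u v with u ≟ v
  ... | yes refl = gram-diagonal Γ u
  ... | no u≢v   = orthogonal S u≢v

-- Switching

val-switch : ∀ s t e → val (Maybe.map (λ r → s Sign.* r Sign.* t) e)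
                     ≡ (s ◃ 1) ℤ.* val e ℤ.* (t ◃ 1)
val-switch Sign.+ Sign.+ nothing       = refl
val-switch Sign.+ Sign.- nothing       = refl
val-switch Sign.- Sign.+ nothing       = refl
val-switch Sign.- Sign.- nothing       = refl
val-switch Sign.+ Sign.+ (just Sign.+) = refl
val-switch Sign.+ Sign.+ (just Sign.-) = refl
val-switch Sign.+ Sign.- (just Sign.+) = refl
val-switch Sign.+ Sign.- (just Sign.-) = refl
val-switch Sign.- Sign.+ (just Sign.+) = refl
val-switch Sign.- Sign.+ (just Sign.-) = refl
val-switch Sign.- Sign.- (just Sign.+) = refl
val-switch Sign.- Sign.- (just Sign.-) = refl

sign-square : ∀ s → (s ◃ 1) ℤ.* (s ◃ 1) ≡ 1ℤ
sign-square Sign.+ = refl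
sign-square Sign.- = refl

-- Switching turns A into ΘAΘ with Θ the diagonal matrix of the signs `θ`. In the square the inner
-- factors give Θ² = I and only the outer ones survive.
gram-switch : ∀ Γ θ u v → gram (switch Γ θ) u v ≡ ((θ u ◃ 1) ℤ.* (θ v ◃ 1)) ℤ.* gram Γ u v
gram-switch Γ θ u v = trans (∑-cong (finite Γ) term)
  (∑-*ˡ (finite Γ) ((θ u ◃ 1) ℤ.* (θ v ◃ 1)) (λ w → val (edge Γ u w) ℤ.* val (edge Γ w v)))
  where
  regroup : ∀ x y z p q → ((x ℤ.* p) ℤ.* z) ℤ.* ((z ℤ.* q) ℤ.* y) ≡ (z ℤ.* z) ℤ.* ((x ℤ.* y) ℤ.* (p ℤ.* q))
  regroup = solve-∀
  term : ∀ w → val (edge (switch Γ θ) u w) ℤ.* val (edge (switch Γ θ) w v)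
             ≡ ((θ u ◃ 1) ℤ.* (θ v ◃ 1)) ℤ.* (val (edge Γ u w) ℤ.* val (edge Γ w v))
  term w =
    trans (cong₂ ℤ._*_ (val-switch (θ u) (θ w) (edge Γ u w)) (val-switch (θ w) (θ v) (edge Γ w v)))
   (trans (regroup (θ u ◃ 1) (θ v ◃ 1) (θ w ◃ 1) (val (edge Γ u w)) (val (edge Γ w v)))
   (trans (cong (λ i → i ℤ.* (((θ u ◃ 1) ℤ.* (θ v ◃ 1)) ℤ.* (val (edge Γ u w) ℤ.* val (edge Γ w v))))
                (sign-square (θ w)))
          (ℤₚ.*-identityˡ _)))

switch-orthogonalRows : ∀ Γ θ {n} → OrthogonalRows Γ n → OrthogonalRows (switch Γ θ) n
switch-orthogonalRows Γ θ S = record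
  { norm       = λ u → trans (gram-switch Γ θ u u)
                   (trans (cong₂ ℤ._*_ (sign-square (θ u)) (norm S u)) (ℤₚ.*-identityˡ _))
  ; orthogonal = λ {u} {v} u≢v → trans (gram-switch Γ θ u v)
                   (trans (cong (ℤ._*_ ((θ u ◃ 1) ℤ.* (θ v ◃ 1))) (orthogonal S u≢v))
                          (ℤₚ.*-zeroʳ ((θ u ◃ 1) ℤ.* (θ v ◃ 1))))
  }

is-just-map⁻ : ∀ {f : Sign → Sign} {e} → Is-just (Maybe.map f e) → Is-just e
is-just-map⁻ {e = just _} _ = just tt

is-just-map : ∀ {f : Sign → Sign} {e} → Is-just e → Is-just (Maybe.map f e)
is-just-map (just _) = just tt

switch-connected : ∀ Γ θ → Connected Γ → Connected (switch Γ θ)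
switch-connected Γ θ (v , con) = v , λ u w → gmap (λ x → x) is-just-map (con u w)

-- a and b are twins when they have the same neighbours and all edges at a are
-- positive; then the sign of the 2-walk a, u, b is that of the edge ub.
record Twins (Γ : SignedGraph) (a b : V Γ) : Set where
  field
    distinct : a ≢ b
    edge-a   : ∀ u → edge Γ a u ≡ Maybe.map (λ _ → Sign.+) (SignedGraph.walkSign Γ a u b)
    edge-b   : ∀ u → edge Γ u b ≡ SignedGraph.walkSign Γ a u b

module TwinProperties (Γ : SignedGraph) {a b : V Γ} (T : Twins Γ a b) where
  open SignedGraph Γ using (edge-sym; loopless)
  open Twins T public

  side : V Γ → Maybe Sign
  side u = SignedGraph.walkSign Γ a u b

  side-a : side a ≡ nothing
  side-a rewrite loopless a = refl

  side-b : side b ≡ nothing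
  side-b rewrite loopless b with edge Γ a b
  ... | nothing = refl
  ... | just _  = refl

  side-∉ : ∀ {u s} → side u ≡ just s → u ∉ a ∷ b ∷ []
  side-∉ eq (here refl)         with () ← trans (sym side-a) eq
  side-∉ eq (there (here refl)) with () ← trans (sym side-b) eq

  edge-a˘ : ∀ u → edge Γ u a ≡ Maybe.map (λ _ → Sign.+) (side u)
  edge-a˘ u = trans (edge-sym u a) (edge-a u)

  edge-b˘ : ∀ u → edge Γ b u ≡ side u
  edge-b˘ u = trans (edge-sym b u) (edge-b u)

-- Switching a splittable pair into twins

-- In this and the next two lemmas `e` and `f` stand for the edges au and ub, and
-- `fromMaybe Sign.+ e` is the switching sign at u. Multiplying `e` by its own sign makes it
-- positive.
normalise-a : ∀ (e f : Maybe Sign) → (Is-just e → Is-just f) →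
  Maybe.map (λ s → s Sign.* fromMaybe Sign.+ e) e
    ≡ Maybe.map (λ _ → Sign.+) (zipWith Sign._*_ e f)
normalise-a nothing       _        _ = refl
normalise-a (just _)      nothing  h with () ← h (just tt)
normalise-a (just Sign.+) (just _) _ = refl
normalise-a (just Sign.-) (just _) _ = refl

normalise-b : ∀ (e f : Maybe Sign) → (Is-just f → Is-just e) →
  Maybe.map (λ s → fromMaybe Sign.+ e Sign.* s Sign.* Sign.+) f ≡ zipWith Sign._*_ e f
normalise-b nothing       nothing       _ = refl
normalise-b nothing       (just _)      h with () ← h (just tt)
normalise-b (just _)      nothing       _ = refl
normalise-b (just Sign.+) (just Sign.+) _ = refl
normalise-b (just Sign.+) (just Sign.-) _ = refl
normalise-b (just Sign.-) (just Sign.+) _ = refl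
normalise-b (just Sign.-) (just Sign.-) _ = refl

normalise-side : ∀ (e f : Maybe Sign) →
  zipWith Sign._*_ (Maybe.map (λ s → s Sign.* fromMaybe Sign.+ e) e)
                   (Maybe.map (λ s → fromMaybe Sign.+ e Sign.* s Sign.* Sign.+) f)
    ≡ zipWith Sign._*_ e f
normalise-side nothing       _             = refl
normalise-side (just _)      nothing       = refl
normalise-side (just Sign.+) (just Sign.+) = refl
normalise-side (just Sign.+) (just Sign.-) = refl
normalise-side (just Sign.-) (just Sign.+) = refl
normalise-side (just Sign.-) (just Sign.-) = refl

module PositiveAt (Γ : SignedGraph) {ℓ} {a b : V Γ} (reg : Regular Γ (2 * ℓ)) (spl : Splittable Γ ℓ a b) where
  open SignedGraph Γ using (Adj; adj?; edge-sym; loopless; walkSign)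
  open Splittable spl

  -- The degree of `a` equals the number of common neighbours of `a` and `b`, so by `count-full`
  -- every neighbour of `a` is a common one.
  adj-a⇒adj-b : ∀ {u} → Adj a u → Adj b u
  adj-a⇒adj-b adj = proj₂ (count-full (finite Γ) (λ w → adj? a w ×-dec adj? b w) (adj? a)
                                      proj₁ (trans common (sym (reg a))) adj)

  adj-b⇒adj-a : ∀ {u} → Adj b u → Adj a u
  adj-b⇒adj-a adj = proj₁ (count-full (finite Γ) (λ w → adj? a w ×-dec adj? b w) (adj? b)
                                      proj₂ (trans common (sym (reg b))) adj)

  -- Otherwise `b`, being a neighbour of `a`, would be a neighbour of itself.
  not-adjacent : edge Γ a b ≡ nothing
  not-adjacent with edge Γ a b | loopless b | adj-a⇒adj-b {b}
  ... | nothing | _  | _ = refl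
  ... | just _  | eq | h with () ← subst Is-just eq (h (just tt))

  Γ⁺ : SignedGraph
  Γ⁺ = positiveAt Γ a

  θ : V Γ → Sign
  θ u = fromMaybe Sign.+ (edge Γ a u)

  -- The switching sign at `a` is the default `Sign.+` because there is no loop at `a`; at `b`, in
  -- `edge⁺-b`, because `a` and `b` are not adjacent.
  edge⁺-a : ∀ u → edge Γ⁺ a u ≡ Maybe.map (λ s → s Sign.* θ u) (edge Γ a u)
  edge⁺-a u rewrite loopless a = refl

  edge⁺-b : ∀ u → edge Γ⁺ u b ≡ Maybe.map (λ s → θ u Sign.* s Sign.* Sign.+) (edge Γ u b)
  edge⁺-b u rewrite not-adjacent = refl

  -- The sign `θ u` enters both edges of the 2-walk through `u` and cancels.
  side⁺ : ∀ u → SignedGraph.walkSign Γ⁺ a u b ≡ walkSign a u b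
  side⁺ u = trans (cong₂ (zipWith Sign._*_) (edge⁺-a u) (edge⁺-b u))
                  (normalise-side (edge Γ a u) (edge Γ u b))

  twins : Twins Γ⁺ a b
  twins = record
    { distinct = distinct
    ; edge-a   = λ u → trans (edge⁺-a u)
        (trans (normalise-a (edge Γ a u) (edge Γ u b) (subst Is-just (edge-sym b u) ∘ adj-a⇒adj-b))
               (cong (Maybe.map _) (sym (side⁺ u))))
    ; edge-b   = λ u → trans (edge⁺-b u)
        (trans (normalise-b (edge Γ a u) (edge Γ u b) (adj-b⇒adj-a ∘ subst Is-just (edge-sym u b)))
               (sym (side⁺ u)))
    }

  -- By splittability `a` itself has neighbours in both P and M, so neither set is empty. These
  -- witnesses later tie the new vertices to `Γ₁`.
  midpoints : ∃[ p ] P Γ⁺ a b p × ∃[ m ] M Γ⁺ a b m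
  midpoints with Equivalence.from (only-a,b a) (inj₁ refl)
  ... | (p , p∈P , _) , (m , m∈M , _) = p , trans (side⁺ p) p∈P , m , trans (side⁺ m) m∈M

-- Gram matrices of the rows of the join

pos : Maybe Sign → ℤ
pos e = val (Maybe.map (λ _ → Sign.+) e)

-- For a vertex u of a twin graph with e = side u, the numbers pos e and val e
-- are the entries of u in the rows of a and b.
Halves : (New → Sign → Maybe Sign) → (k l : New → ℤ) → Maybe Sign → Set
Halves attach k l e = ∀ x → + 2 ℤ.* val (e >>= attach x) ≡ k x ℤ.* pos e ℤ.+ l x ℤ.* val e

halves? : ∀ attach k l e → Dec (Halves attach k l e)
halves? attach k l e = Finₚ.all? λ x → + 2 ℤ.* val (e >>= attach x) ℤₚ.≟ k x ℤ.* pos e ℤ.+ l x ℤ.* val e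

module TwinGram (Γ : SignedGraph) {a b : V Γ} (T : Twins Γ a b) {n} (S : OrthogonalRows Γ n)
                (attach : New → Sign → Maybe Sign) (k l : New → ℤ)
                (halves : ∀ e → Halves attach k l e) where
  open TwinProperties Γ T

  Δ : SignedGraph
  Δ = Γ − (a ∷ b ∷ [])

  row : V Γ → V Γ → ℤ
  row u w = val (edge Γ u w)

  new : New → V Γ → ℤ
  new x w = val (side w >>= attach x)

  ⟨_,_⟩ : (V Γ → ℤ) → (V Γ → ℤ) → ℤ
  ⟨ f , g ⟩ = SignedGraph.∑ Δ (λ w → f (value w) ℤ.* g (value w))

  α β : V Γ → ℤ
  α = pos ∘ side
  β = val ∘ side

  ⟨,⟩-comm : ∀ f g → ⟨ f , g ⟩ ≡ ⟨ g , f ⟩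
  ⟨,⟩-comm f g = ∑-cong (finite Δ) λ w → ℤₚ.*-comm (f (value w)) (g (value w))

  -- The two terms missing from the inner product are those at `a` and `b`, where `g` vanishes.
  ⟨,⟩-restrict : ∀ f g → g a ≡ 0ℤ → g b ≡ 0ℤ → ⟨ f , g ⟩ ≡ SignedGraph.∑ Γ (λ w → f w ℤ.* g w)
  ⟨,⟩-restrict f g ga≡0 gb≡0 = sym (begin
    SignedGraph.∑ Γ (λ w → f w ℤ.* g w)
      ≡⟨ ∑-∖ (finite Γ) distinct (λ w → f w ℤ.* g w) ⟩
    f a ℤ.* g a ℤ.+ (f b ℤ.* g b ℤ.+ ⟨ f , g ⟩)
      ≡⟨ cong₂ (λ i j → f a ℤ.* i ℤ.+ (f b ℤ.* j ℤ.+ ⟨ f , g ⟩)) ga≡0 gb≡0 ⟩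
    f a ℤ.* 0ℤ ℤ.+ (f b ℤ.* 0ℤ ℤ.+ ⟨ f , g ⟩)
      ≡⟨ vanish (f a) (f b) ⟨ f , g ⟩ ⟩
    ⟨ f , g ⟩ ∎)
    where
    vanish : ∀ x y z → x ℤ.* 0ℤ ℤ.+ (y ℤ.* 0ℤ ℤ.+ z) ≡ z
    vanish = solve-∀

  row-α : ∀ u → ⟨ row u , α ⟩ ≡ gram Γ u a
  row-α u = trans (⟨,⟩-restrict (row u) α (cong pos side-a) (cong pos side-b))
                  (∑-cong (finite Γ) λ w → cong (λ e → row u w ℤ.* val e) (sym (edge-a˘ w)))

  row-β : ∀ u → ⟨ row u , β ⟩ ≡ gram Γ u b
  row-β u = trans (⟨,⟩-restrict (row u) β (cong val side-a) (cong val side-b))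
                  (∑-cong (finite Γ) λ w → cong (λ e → row u w ℤ.* val e) (sym (edge-b w)))

  α-pair : ∀ g → ⟨ α , g ⟩ ≡ ⟨ row a , g ⟩
  α-pair g = ∑-cong (finite Δ) λ w → cong (λ e → val e ℤ.* g (value w)) (sym (edge-a (value w)))

  β-pair : ∀ g → ⟨ β , g ⟩ ≡ ⟨ row b , g ⟩
  β-pair g = ∑-cong (finite Δ) λ w → cong (λ e → val e ℤ.* g (value w)) (sym (edge-b˘ (value w)))

  -- `halves` extended linearly over the sum. Doubling keeps the coefficients of a new row in the
  -- old rows integral.
  double : ∀ f x → + 2 ℤ.* ⟨ f , new x ⟩ ≡ k x ℤ.* ⟨ f , α ⟩ ℤ.+ l x ℤ.* ⟨ f , β ⟩
  double f x = begin
    + 2 ℤ.* ⟨ f , new x ⟩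
      ≡⟨ ∑-*ˡ (finite Δ) (+ 2) (λ w → f (value w) ℤ.* new x (value w)) ⟨
    SignedGraph.∑ Δ (λ w → + 2 ℤ.* (f (value w) ℤ.* new x (value w)))
      ≡⟨ ∑-cong (finite Δ) term ⟩
    SignedGraph.∑ Δ (λ w → k x ℤ.* (f (value w) ℤ.* α (value w)) ℤ.+ l x ℤ.* (f (value w) ℤ.* β (value w)))
      ≡⟨ ∑-linear (finite Δ) (k x) (l x) (λ w → f (value w) ℤ.* α (value w)) (λ w → f (value w) ℤ.* β (value w)) ⟩
    k x ℤ.* ⟨ f , α ⟩ ℤ.+ l x ℤ.* ⟨ f , β ⟩ ∎
    where
    swap : ∀ i j h → i ℤ.* (j ℤ.* h) ≡ j ℤ.* (i ℤ.* h)
    swap = solve-∀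
    distrib : ∀ i k l p q → i ℤ.* (k ℤ.* p ℤ.+ l ℤ.* q) ≡ k ℤ.* (i ℤ.* p) ℤ.+ l ℤ.* (i ℤ.* q)
    distrib = solve-∀
    term : ∀ w → + 2 ℤ.* (f (value w) ℤ.* new x (value w))
               ≡ k x ℤ.* (f (value w) ℤ.* α (value w)) ℤ.+ l x ℤ.* (f (value w) ℤ.* β (value w))
    term w =
      trans (swap (+ 2) (f (value w)) (new x (value w)))
     (trans (cong (ℤ._*_ (f (value w))) (halves (side (value w)) x))
            (distrib (f (value w)) (k x) (l x) (α (value w)) (β (value w))))

  -- Up to the factor 2, a new row is a combination of the rows of `a` and `b`, and both are
  -- orthogonal to the row of any third vertex.
  row-new : ∀ {u} x → u ∉ a ∷ b ∷ [] → ⟨ row u , new x ⟩ ≡ 0ℤ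
  row-new {u} x u∉ = ℤₚ.*-cancelˡ-≡ (+ 2) _ _ (begin
    + 2 ℤ.* ⟨ row u , new x ⟩
      ≡⟨ double (row u) x ⟩
    k x ℤ.* ⟨ row u , α ⟩ ℤ.+ l x ℤ.* ⟨ row u , β ⟩
      ≡⟨ cong₂ (λ i j → k x ℤ.* i ℤ.+ l x ℤ.* j)
               (trans (row-α u) (orthogonal S (u∉ ∘ here)))
               (trans (row-β u) (orthogonal S (u∉ ∘ there ∘ here))) ⟩
    k x ℤ.* 0ℤ ℤ.+ l x ℤ.* 0ℤ
      ≡⟨ vanish (k x) (l x) ⟩
    0ℤ ∎)
    where
    vanish : ∀ x y → x ℤ.* 0ℤ ℤ.+ y ℤ.* 0ℤ ≡ 0ℤ
    vanish = solve-∀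

  -- Exchanging the arguments makes `α` the row of `a`, against which only the `a`-component of the
  -- new row survives.
  new-α : ∀ x → + 2 ℤ.* ⟨ new x , α ⟩ ≡ k x ℤ.* n
  new-α x = begin
    + 2 ℤ.* ⟨ new x , α ⟩
      ≡⟨ cong (ℤ._*_ (+ 2)) (trans (⟨,⟩-comm (new x) α) (α-pair (new x))) ⟩
    + 2 ℤ.* ⟨ row a , new x ⟩
      ≡⟨ double (row a) x ⟩
    k x ℤ.* ⟨ row a , α ⟩ ℤ.+ l x ℤ.* ⟨ row a , β ⟩
      ≡⟨ cong₂ (λ i j → k x ℤ.* i ℤ.+ l x ℤ.* j)
               (trans (row-α a) (norm S a)) (trans (row-β a) (orthogonal S distinct)) ⟩
    k x ℤ.* n ℤ.+ l x ℤ.* 0ℤ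
      ≡⟨ vanish (k x ℤ.* n) (l x) ⟩
    k x ℤ.* n ∎
    where
    vanish : ∀ x y → x ℤ.+ y ℤ.* 0ℤ ≡ x
    vanish = solve-∀

  new-β : ∀ x → + 2 ℤ.* ⟨ new x , β ⟩ ≡ l x ℤ.* n
  new-β x = begin
    + 2 ℤ.* ⟨ new x , β ⟩
      ≡⟨ cong (ℤ._*_ (+ 2)) (trans (⟨,⟩-comm (new x) β) (β-pair (new x))) ⟩
    + 2 ℤ.* ⟨ row b , new x ⟩
      ≡⟨ double (row b) x ⟩
    k x ℤ.* ⟨ row b , α ⟩ ℤ.+ l x ℤ.* ⟨ row b , β ⟩
      ≡⟨ cong₂ (λ i j → k x ℤ.* i ℤ.+ l x ℤ.* j)
               (trans (row-α b) (orthogonal S (distinct ∘ sym))) (trans (row-β b) (norm S b)) ⟩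
    k x ℤ.* 0ℤ ℤ.+ l x ℤ.* n
      ≡⟨ vanish (k x) (l x ℤ.* n) ⟩
    l x ℤ.* n ∎
    where
    vanish : ∀ x y → x ℤ.* 0ℤ ℤ.+ y ≡ y
    vanish = solve-∀

  -- Each of the two new rows is expanded once in the orthogonal rows of `a` and `b`, at the cost of
  -- a factor 2 each time.
  new-new : ∀ x y → + 4 ℤ.* ⟨ new x , new y ⟩ ≡ (k x ℤ.* k y ℤ.+ l x ℤ.* l y) ℤ.* n
  new-new x y = begin
    + 4 ℤ.* ⟨ new x , new y ⟩
      ≡⟨ ℤₚ.*-assoc (+ 2) (+ 2) ⟨ new x , new y ⟩ ⟩
    + 2 ℤ.* (+ 2 ℤ.* ⟨ new x , new y ⟩)
      ≡⟨ cong (ℤ._*_ (+ 2)) (double (new x) y) ⟩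
    + 2 ℤ.* (k y ℤ.* ⟨ new x , α ⟩ ℤ.+ l y ℤ.* ⟨ new x , β ⟩)
      ≡⟨ distrib (+ 2) (k y) (l y) ⟨ new x , α ⟩ ⟨ new x , β ⟩ ⟩
    k y ℤ.* (+ 2 ℤ.* ⟨ new x , α ⟩) ℤ.+ l y ℤ.* (+ 2 ℤ.* ⟨ new x , β ⟩)
      ≡⟨ cong₂ (λ i j → k y ℤ.* i ℤ.+ l y ℤ.* j) (new-α x) (new-β x) ⟩
    k y ℤ.* (k x ℤ.* n) ℤ.+ l y ℤ.* (l x ℤ.* n)
      ≡⟨ collect (k x) (k y) (l x) (l y) n ⟩
    (k x ℤ.* k y ℤ.+ l x ℤ.* l y) ℤ.* n ∎
    where
    distrib : ∀ i k l p q → i ℤ.* (k ℤ.* p ℤ.+ l ℤ.* q) ≡ k ℤ.* (i ℤ.* p) ℤ.+ l ℤ.* (i ℤ.* q)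
    distrib = solve-∀
    collect : ∀ p q r s n → q ℤ.* (p ℤ.* n) ℤ.+ s ℤ.* (r ℤ.* n) ≡ (p ℤ.* q ℤ.+ r ℤ.* s) ℤ.* n
    collect = solve-∀

  -- Isolates the 2-walks with midpoint `a` or `b`. Deleting these vertices removes exactly the last
  -- bracket, which the new vertices have to supply again.
  row-row : ∀ u v → gram Γ u v ≡
    SignedGraph.∑ Δ (λ w → row u (value w) ℤ.* row (value w) v) ℤ.+ (α u ℤ.* α v ℤ.+ β u ℤ.* β v)
  row-row u v = begin
    gram Γ u v
      ≡⟨ ∑-∖ (finite Γ) distinct (λ w → row u w ℤ.* row w v) ⟩
    row u a ℤ.* row a v ℤ.+ (row u b ℤ.* row b v ℤ.+ s)
      ≡⟨ cong₂ (λ i j → i ℤ.+ (j ℤ.+ s))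
               (cong₂ (λ e f → val e ℤ.* val f) (edge-a˘ u) (edge-a v))
               (cong₂ (λ e f → val e ℤ.* val f) (edge-b u) (edge-b˘ v)) ⟩
    α u ℤ.* α v ℤ.+ (β u ℤ.* β v ℤ.+ s)
      ≡⟨ rotate (α u ℤ.* α v) (β u ℤ.* β v) s ⟩
    s ℤ.+ (α u ℤ.* α v ℤ.+ β u ℤ.* β v) ∎
    where
    s = SignedGraph.∑ Δ (λ w → row u (value w) ℤ.* row (value w) v)
    rotate : ∀ x y z → x ℤ.+ (y ℤ.+ z) ≡ z ℤ.+ (x ℤ.+ y)
    rotate = solve-∀

-- The Hadamard matrix of coefficients and the columns at old vertices

-- Read off from the indicator functions (α + β)/2 of P and (α - β)/2 of M. For instance `b₂` is -1
-- on M, which gives (-1, 1), and 1 on P′, which gives (1, 1).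
k₁ l₁ k₂ l₂ : New → ℤ
k₁ a₁ = 1ℤ
k₁ a₂ = 1ℤ
k₁ b₁ = 1ℤ
k₁ b₂ = -1ℤ
l₁ a₁ = 1ℤ
l₁ a₂ = 1ℤ
l₁ b₁ = -1ℤ
l₁ b₂ = 1ℤ
k₂ a₁ = -1ℤ
k₂ a₂ = 1ℤ
k₂ b₁ = 1ℤ
k₂ b₂ = 1ℤ
l₂ a₁ = 1ℤ
l₂ a₂ = -1ℤ
l₂ b₁ = 1ℤ
l₂ b₂ = 1ℤ

halves₁ : ∀ e → Halves attach₁ k₁ l₁ e
halves₁ nothing       = from-yes (halves? attach₁ k₁ l₁ nothing)
halves₁ (just Sign.+) = from-yes (halves? attach₁ k₁ l₁ (just Sign.+))
halves₁ (just Sign.-) = from-yes (halves? attach₁ k₁ l₁ (just Sign.-))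

halves₂ : ∀ e → Halves attach₂ k₂ l₂ e
halves₂ nothing       = from-yes (halves? attach₂ k₂ l₂ nothing)
halves₂ (just Sign.+) = from-yes (halves? attach₂ k₂ l₂ (just Sign.+))
halves₂ (just Sign.-) = from-yes (halves? attach₂ k₂ l₂ (just Sign.-))

-- The entry of HHᵀ at `x`, `y`, where row `x` of H is (`k₁ x`, `l₁ x`, `k₂ x`, `l₂ x`).
hadamard : New → New → ℤ
hadamard x y = (k₁ x ℤ.* k₁ y ℤ.+ l₁ x ℤ.* l₁ y) ℤ.+ (k₂ x ℤ.* k₂ y ℤ.+ l₂ x ℤ.* l₂ y)

hadamard-norm : ∀ x → hadamard x x ≡ + 4
hadamard-norm = from-yes (Finₚ.all? λ x → hadamard x x ℤₚ.≟ + 4)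

hadamard-orthogonal : ∀ x y → x ≢ y → hadamard x y ≡ 0ℤ
hadamard-orthogonal = from-yes (Finₚ.all? λ x → Finₚ.all? λ y →
  ¬? (x Finₚ.≟ y) →-dec (hadamard x y ℤₚ.≟ 0ℤ))

∑-new : (New → ℤ) → ℤ
∑-new = Finite.∑ (fin-finite 4)

column-sum : (attach : New → Sign → Maybe Sign) (d e : Maybe Sign) → ℤ
column-sum attach d e = ∑-new (λ x → val (d >>= attach x) ℤ.* val (e >>= attach x))

-- The columns (1, 1, 0, 0) of P and (0, 0, 1, -1) of M have the same inner products as the old
-- pairs (1, 1) and (1, -1). So the new midpoints make up for `a` and `b`.
columns₁ : ∀ d e → column-sum attach₁ d e ≡ pos d ℤ.* pos e ℤ.+ val d ℤ.* val e
columns₁ nothing       nothing       = refl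
columns₁ nothing       (just Sign.+) = refl
columns₁ nothing       (just Sign.-) = refl
columns₁ (just Sign.+) nothing       = refl
columns₁ (just Sign.+) (just Sign.+) = refl
columns₁ (just Sign.+) (just Sign.-) = refl
columns₁ (just Sign.-) nothing       = refl
columns₁ (just Sign.-) (just Sign.+) = refl
columns₁ (just Sign.-) (just Sign.-) = refl

columns₂ : ∀ d e → column-sum attach₂ d e ≡ pos d ℤ.* pos e ℤ.+ val d ℤ.* val e
columns₂ nothing       nothing       = refl
columns₂ nothing       (just Sign.+) = refl
columns₂ nothing       (just Sign.-) = refl
columns₂ (just Sign.+) nothing       = refl
columns₂ (just Sign.+) (just Sign.+) = refl
columns₂ (just Sign.+) (just Sign.-) = refl
columns₂ (just Sign.-) nothing       = refl
columns₂ (just Sign.-) (just Sign.+) = refl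
columns₂ (just Sign.-) (just Sign.-) = refl

-- The columns of P′ and M′ are (0, 0, 1, 1) and (-1, 1, 0, 0). The negative edges at `a₁` and `b₂`
-- make P orthogonal to M′ and M orthogonal to P′; the other pairs have disjoint supports.
columns₁₂ : ∀ d e → ∑-new (λ x → val (d >>= attach₁ x) ℤ.* val (e >>= attach₂ x)) ≡ 0ℤ
columns₁₂ nothing       nothing       = refl
columns₁₂ nothing       (just Sign.+) = refl
columns₁₂ nothing       (just Sign.-) = refl
columns₁₂ (just Sign.+) nothing       = refl
columns₁₂ (just Sign.+) (just Sign.+) = refl
columns₁₂ (just Sign.+) (just Sign.-) = refl
columns₁₂ (just Sign.-) nothing       = refl
columns₁₂ (just Sign.-) (just Sign.+) = refl
columns₁₂ (just Sign.-) (just Sign.-) = refl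

bind-just : ∀ {f : Sign → Maybe Sign} {e s t} → e ≡ just s → f s ≡ just t → Is-just (e >>= f)
bind-just refl fs≡t = subst Is-just (sym fs≡t) (just tt)

-- Orthogonality of the rows of the join

module Join (Γ₁ Γ₂ : SignedGraph) {a b : V Γ₁} {a′ b′ : V Γ₂}
            (T₁ : Twins Γ₁ a b) (T₂ : Twins Γ₂ a′ b′) where

  J : SignedGraph
  J = splitJoin Γ₁ a b Γ₂ a′ b′

  X₁ : List (V Γ₁)
  X₁ = a ∷ b ∷ []

  X₂ : List (V Γ₂)
  X₂ = a′ ∷ b′ ∷ []

  module P₁ = TwinProperties Γ₁ T₁
  module P₂ = TwinProperties Γ₂ T₂

  module _ {n : ℤ} (S₁ : OrthogonalRows Γ₁ n) (S₂ : OrthogonalRows Γ₂ n) where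

    private
      module G₁ = TwinGram Γ₁ T₁ S₁ attach₁ k₁ l₁ halves₁
      module G₂ = TwinGram Γ₂ T₂ S₂ attach₂ k₂ l₂ halves₂

    walk : V J → V J → V J → ℤ
    walk u v w = val (edge J u w) ℤ.* val (edge J w v)

    gram-blocks : ∀ u v {x y z} →
      SignedGraph.∑ G₁.Δ (walk u v ∘ inj₁) ≡ x →
      SignedGraph.∑ G₂.Δ (walk u v ∘ inj₂ ∘ inj₁) ≡ y →
      ∑-new (walk u v ∘ inj₂ ∘ inj₂) ≡ z →
      gram J u v ≡ x ℤ.+ (y ℤ.+ z)
    gram-blocks u v refl refl refl =
      trans (∑-⊎ (finite G₁.Δ) (⊎-finite (finite G₂.Δ) (fin-finite 4)) (walk u v))
            (cong (ℤ._+_ (SignedGraph.∑ G₁.Δ (walk u v ∘ inj₁)))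
                  (∑-⊎ (finite G₂.Δ) (fin-finite 4) (walk u v ∘ inj₂)))

    gram-11 : ∀ u v → gram J (inj₁ u) (inj₁ v) ≡ gram Γ₁ (value u) (value v)
    gram-11 u v = trans
      (gram-blocks (inj₁ u) (inj₁ v) refl
        (∑-zero (finite G₂.Δ) (λ _ → refl)) (columns₁ (P₁.side (value u)) (P₁.side (value v))))
      (trans (cong (ℤ._+_ s) (ℤₚ.+-identityˡ _)) (sym (G₁.row-row (value u) (value v))))
      where s = SignedGraph.∑ G₁.Δ (λ w → G₁.row (value u) (value w) ℤ.* G₁.row (value w) (value v))

    gram-22 : ∀ u v → gram J (inj₂ (inj₁ u)) (inj₂ (inj₁ v)) ≡ gram Γ₂ (value u) (value v)
    gram-22 u v = trans
      (gram-blocks (inj₂ (inj₁ u)) (inj₂ (inj₁ v))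
        (∑-zero (finite G₁.Δ) (λ _ → refl)) refl (columns₂ (P₂.side (value u)) (P₂.side (value v))))
      (trans (ℤₚ.+-identityˡ _) (sym (G₂.row-row (value u) (value v))))

    gram-12 : ∀ u v → gram J (inj₁ u) (inj₂ (inj₁ v)) ≡ 0ℤ
    gram-12 u v = gram-blocks (inj₁ u) (inj₂ (inj₁ v))
      (∑-zero (finite G₁.Δ) (λ w → ℤₚ.*-zeroʳ (val (edge G₁.Δ u w))))
      (∑-zero (finite G₂.Δ) (λ _ → refl))
      (columns₁₂ (P₁.side (value u)) (P₂.side (value v)))

    gram-1-new : ∀ u x → gram J (inj₁ u) (inj₂ (inj₂ x)) ≡ 0ℤ
    gram-1-new u x = gram-blocks (inj₁ u) (inj₂ (inj₂ x))
      (G₁.row-new x (∖-∉ (finite Γ₁) u))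
      (∑-zero (finite G₂.Δ) (λ _ → refl))
      (∑-zero (fin-finite 4) (λ y → ℤₚ.*-zeroʳ (G₁.new y (value u))))

    gram-2-new : ∀ u x → gram J (inj₂ (inj₁ u)) (inj₂ (inj₂ x)) ≡ 0ℤ
    gram-2-new u x = gram-blocks (inj₂ (inj₁ u)) (inj₂ (inj₂ x))
      (∑-zero (finite G₁.Δ) (λ _ → refl))
      (G₂.row-new x (∖-∉ (finite Γ₂) u))
      (∑-zero (fin-finite 4) (λ y → ℤₚ.*-zeroʳ (G₂.new y (value u))))

    -- New vertices are pairwise non-adjacent, so only midpoints in the two old graphs contribute,
    -- and their `new-new` values add up to an entry of `hadamard`.
    gram-new : ∀ x y → + 4 ℤ.* gram J (inj₂ (inj₂ x)) (inj₂ (inj₂ y)) ≡ hadamard x y ℤ.* n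
    gram-new x y = begin
      + 4 ℤ.* gram J (inj₂ (inj₂ x)) (inj₂ (inj₂ y))
        ≡⟨ cong (ℤ._*_ (+ 4)) (gram-blocks (inj₂ (inj₂ x)) (inj₂ (inj₂ y)) refl refl refl) ⟩
      + 4 ℤ.* (s ℤ.+ (t ℤ.+ 0ℤ))
        ≡⟨ cong (λ i → + 4 ℤ.* (s ℤ.+ i)) (ℤₚ.+-identityʳ t) ⟩
      + 4 ℤ.* (s ℤ.+ t)
        ≡⟨ ℤₚ.*-distribˡ-+ (+ 4) s t ⟩
      + 4 ℤ.* s ℤ.+ + 4 ℤ.* t
        ≡⟨ cong₂ ℤ._+_ (G₁.new-new x y) (G₂.new-new x y) ⟩
      (k₁ x ℤ.* k₁ y ℤ.+ l₁ x ℤ.* l₁ y) ℤ.* n ℤ.+ (k₂ x ℤ.* k₂ y ℤ.+ l₂ x ℤ.* l₂ y) ℤ.* n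
        ≡⟨ ℤₚ.*-distribʳ-+ n (k₁ x ℤ.* k₁ y ℤ.+ l₁ x ℤ.* l₁ y) (k₂ x ℤ.* k₂ y ℤ.+ l₂ x ℤ.* l₂ y) ⟨
      hadamard x y ℤ.* n ∎
      where
      s = G₁.⟨ G₁.new x , G₁.new y ⟩
      t = G₂.⟨ G₂.new x , G₂.new y ⟩

    join-orthogonalRows : OrthogonalRows J n
    join-orthogonalRows = record { norm = diagonal ; orthogonal = λ {u} {v} → off u v }
      where
      diagonal : ∀ u → gram J u u ≡ n
      diagonal (inj₁ u)        = trans (gram-11 u u) (norm S₁ (value u))
      diagonal (inj₂ (inj₁ u)) = trans (gram-22 u u) (norm S₂ (value u))
      diagonal (inj₂ (inj₂ x)) = ℤₚ.*-cancelˡ-≡ (+ 4) _ _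
        (trans (gram-new x x) (cong (λ i → i ℤ.* n) (hadamard-norm x)))

      off : ∀ u v → u ≢ v → gram J u v ≡ 0ℤ
      off (inj₁ u) (inj₁ v) u≢v =
        trans (gram-11 u v) (orthogonal S₁ (u≢v ∘ cong inj₁ ∘ value-injective))
      off (inj₂ (inj₁ u)) (inj₂ (inj₁ v)) u≢v =
        trans (gram-22 u v) (orthogonal S₂ (u≢v ∘ cong (inj₂ ∘ inj₁) ∘ value-injective))
      off (inj₂ (inj₂ x)) (inj₂ (inj₂ y)) x≢y = ℤₚ.*-cancelˡ-≡ (+ 4) _ _
        (trans (gram-new x y) (cong (λ i → i ℤ.* n) (hadamard-orthogonal x y (x≢y ∘ cong (inj₂ ∘ inj₂)))))
      off (inj₁ u) (inj₂ (inj₁ v)) _ = gram-12 u v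
      off (inj₁ u) (inj₂ (inj₂ x)) _ = gram-1-new u x
      off (inj₂ (inj₁ u)) (inj₂ (inj₂ x)) _ = gram-2-new u x
      off (inj₂ (inj₁ u)) (inj₁ v) _ = trans (gram-sym J (inj₂ (inj₁ u)) (inj₁ v)) (gram-12 v u)
      off (inj₂ (inj₂ x)) (inj₁ v) _ = trans (gram-sym J (inj₂ (inj₂ x)) (inj₁ v)) (gram-1-new v x)
      off (inj₂ (inj₂ x)) (inj₂ (inj₁ v)) _ =
        trans (gram-sym J (inj₂ (inj₂ x)) (inj₂ (inj₁ v))) (gram-2-new v x)

  -- Connectivity of the join

  module _ {p m : V Γ₁} (p∈P : P Γ₁ a b p) (m∈M : M Γ₁ a b m)
           (con₁ : Connected (Γ₁ − X₁)) (con₂ : Connected Γ₂) where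

    open SignedGraph J using (Adj; edge-sym)
    open DecMembership (SignedGraph._≟_ Γ₂) using (_∈?_)

    adj-sym : ∀ {u v} → Adj u v → Adj v u
    adj-sym {u} {v} = subst Is-just (edge-sym u v)

    p̂ m̂ : V Γ₁ ∖ X₁
    p̂ = p , [ P₁.side-∉ p∈P ]
    m̂ = m , [ P₁.side-∉ m∈M ]

    Reach : V J → Set
    Reach u = Star Adj u (inj₁ p̂)

    reach-1 : ∀ u → Reach (inj₁ u)
    reach-1 u = gmap inj₁ (λ adj → adj) (proj₂ con₁ u p̂)

    reach-new : ∀ x → Reach (inj₂ (inj₂ x))
    reach-new a₁ = bind-just p∈P refl ◅ ε
    reach-new a₂ = bind-just p∈P refl ◅ ε
    -- On the side of `Γ₁` the vertices `b₁` and `b₂` see only M, so the walk enters at `m̂` and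
    -- continues inside `Γ₁` without `a` and `b`.
    reach-new b₁ = bind-just m∈M refl ◅ reach-1 m̂
    reach-new b₂ = bind-just m∈M refl ◅ reach-1 m̂

    -- A vertex of P′ is a neighbour of `b₁` and a vertex of M′ is a neighbour of `a₁`.
    reach-side : ∀ v → Is-just (P₂.side (value v)) → Reach (inj₂ (inj₁ v))
    reach-side v adj with P₂.side (value v) in eq
    ... | just Sign.+ = bind-just eq refl ◅ reach-new b₁
    ... | just Sign.- = bind-just eq refl ◅ reach-new a₁

    -- `Γ₂` without `a′` and `b′` is not assumed connected. The path is followed only up to its
    -- first visit to `a′` or `b′`; the vertex before that lies in P′ or M′.
    reach-path : ∀ v {u} → Star (SignedGraph.Adj Γ₂) (value v) u → u ∈ X₂ → Reach (inj₂ (inj₁ v))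
    reach-path v ε u∈X₂ = contradiction u∈X₂ (∖-∉ (finite Γ₂) v)
    reach-path v (_◅_ {j = w} v~w path) u∈X₂ with w ∈? X₂
    ... | no w∉X₂ = v~w ◅ reach-path (w , [ w∉X₂ ]) path u∈X₂
    ... | yes (here refl)         = reach-side v (is-just-map⁻ (subst Is-just (P₂.edge-a˘ (value v)) v~w))
    ... | yes (there (here refl)) = reach-side v (subst Is-just (P₂.edge-b (value v)) v~w)

    reach : ∀ u → Reach u
    reach (inj₁ u)        = reach-1 u
    reach (inj₂ (inj₁ v)) = reach-path v (proj₂ con₂ (value v) a′) (here refl)
    reach (inj₂ (inj₂ x)) = reach-new x

    join-connected : Connected J
    join-connected = inj₁ p̂ , λ u v → reach u ◅◅ reverse (λ {x} {y} → adj-sym {x} {y}) (reach v)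

lemma3p5 : (ℓ : ℕ) (Γ₁ Γ₂ : SignedGraph) (a b : V Γ₁) (a′ b′ : V Γ₂) →
    Regular Γ₁ (2 * ℓ) → Orthogonal Γ₁ →
    Regular Γ₂ (2 * ℓ) → Orthogonal Γ₂ →
    Splittable Γ₁ ℓ a b → Splittable Γ₂ ℓ a′ b′ →
    KConnected 3 Γ₁ →
    Regular (splitJoin (positiveAt Γ₁ a) a b (positiveAt Γ₂ a′) a′ b′) (2 * ℓ)
    × Orthogonal (splitJoin (positiveAt Γ₁ a) a b (positiveAt Γ₂ a′) a′ b′)
lemma3p5 ℓ Γ₁ Γ₂ a b a′ b′ reg₁ orth₁ reg₂ orth₂ spl₁ spl₂ (_ , connected-minus)
  with p , p∈P , m , m∈M ← PositiveAt.midpoints Γ₁ reg₁ spl₁ =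
  regular-orthogonal J
    (join-connected p∈P m∈M
      -- `X₁` has length 2, below the bound 3. Deleting vertices and then switching gives the same
      -- edges, by definition, as switching first.
      (switch-connected (Γ₁ − X₁) (H₁.θ ∘ value) (connected-minus X₁ (s≤s (s≤s (s≤s z≤n)))))
      (switch-connected Γ₂ H₂.θ (proj₁ orth₂)))
    (join-orthogonalRows (switch-orthogonalRows Γ₁ H₁.θ (orthogonalRows Γ₁ reg₁ orth₁))
                         (switch-orthogonalRows Γ₂ H₂.θ (orthogonalRows Γ₂ reg₂ orth₂)))
  where
  module H₁ = PositiveAt Γ₁ reg₁ spl₁
  module H₂ = PositiveAt Γ₂ reg₂ spl₂
  open Join H₁.Γ⁺ H₂.Γ⁺ H₁.twins H₂.twins
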